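{- Let $G$ be a connected locally finite graph. For every edge $xy\in E_{\mathrm{tl}}(G)$, $$\mathrm{DN}_{\mathrm{LLY}}(G)\ge\sqrt{(d_x-1)(d_y-1)}.$$ Consequently, if $E_{\mathrm{tl}}(G)\neq\varnothing$, then $$\mathrm{DN}_{\mathrm{LLY}}(G)\ge\sup\left\{\sqrt{(d_x-1)(d_y-1)}: xy\in E_{\mathrm{tl}}(G)\right\}.$$
   Context: Graphs are simple and undirected, possibly infinite; $d_x$ is the combinatorial degree of $x$ in $G$. Let $d(\cdot,\cdot)$ be the combinatorial graph distance. For a positive edge weight $w:E\to(0,\infty)$ put $d_x^w:=\sum_{y\sim x}w_{xy}$. For $\alpha\in[0,1]$ let $\mu_x^{\alpha,w}$ be the probability measure with $\mu_x^{\alpha,w}(x)=\alpha$, $\mu_x^{\alpha,w}(z)=(1-\alpha)w_{xz}/d_x^w$ for $z\sim x$, and $0$ otherwise. Let $W_1$ be the $1$-Wasserstein distance with respect to $d$. For $x\sim y$ let $\kappa_\alpha^w(x,y):=1-W_1(\mu_x^{\alpha,w},\mu_y^{\alpha,w})$ and define the weighted Lin--Lu--Yau curvature $\kappa_{\mathrm{LLY}}^w(x,y):=\lim_{\alpha\to1^- }\kappa_\alpha^w(x,y)/(1-\alpha)$. For connected locally finite $G$ with $E\neq\varnothing$: $\mathrm{Dist}(w):=\sup_{e\in E}w_e/\inf_{e\in E}w_e$, with value $+\infty$ if the supremum is infinite or the infimum is $0$; a positive weight $w$ is admissible if $\kappa_{\mathrm{LLY}}^w(e)\ge0$ for every $e\in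 E$; and $\mathrm{DN}_{\mathrm{LLY}}(G):=\inf\{\mathrm{Dist}(w): w \text{ admissible}\}$, with value $+\infty$ if no admissible weight has finite distortion. $E_{\mathrm{tl}}(G)$ is the set of tree-like edges of $G$, i.e. edges lying on no cycle of $G$ of length $3$, $4$ or $5$. -}

module Defs where

open import Algebra.Bundles using (CommutativeRing)
open import Algebra.Structures using (IsCommutativeRing)
open import Axiom.ExcludedMiddle using (ExcludedMiddle)
open import Data.Empty using (⊥-elim)
open import Data.Fin.Base using (Fin; toℕ)
open import Data.List.Base using (List; []; _∷_; length; map; foldr)
open import Data.List.Membership.Propositional using (_∈_; _∉_)
open import Data.List.Relation.Unary.All.Properties using (¬Any⇒All¬)
open import Data.List.Relation.Unary.Any using (here; there)
open import Data.List.Relation.Unary.Unique.Propositional using (Unique)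
open import Data.List.Relation.Unary.AllPairs using (_∷_)
open import Data.Nat.Base using (ℕ; zero; suc; NonZero)
open import Data.Nat.DivMod using (_mod_)
open import Data.Product.Base using (Σ; ∃; _×_; _,_; proj₁; proj₂)
open import Data.Sum.Base using (_⊎_; inj₁; inj₂)
open import Function.Base using (_∘_)
open import Function.Bundles using (_⇔_; Equivalence)
open import Function.Definitions using (Injective)
open import Level using (0ℓ)
open import Relation.Binary.Core using (Rel)
open import Relation.Binary.Definitions using (Symmetric; Irreflexive)
open import Relation.Binary.PropositionalEquality.Core using (_≡_; refl)
open import Relation.Binary.Structures using (IsTotalOrder)
open import Relation.Nullary.Construct.Add.Supremum using (_⁺; ⊤⁺; [_])
open import Relation.Nullary.Decidable.Core using (yes; no)
open import Relation.Nullary.Negation.Core using (¬_)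
import Algebra.Definitions.RawMonoid as RawMonoidDefs
import Data.Nat.Base as ℕ
import Relation.Binary.Construct.Add.Supremum.NonStrict as AddSupremum
import Relation.Binary.Construct.NonStrictToStrict as NonStrictToStrict

module Bounds {A : Set} (_≤_ : Rel A 0ℓ) where

  IsUpperBound IsLowerBound IsSup IsInf : {I : Set} → (I → A) → A → Set
  IsUpperBound f b = ∀ i → f i ≤ b
  IsLowerBound f b = ∀ i → b ≤ f i
  IsSup f s = IsUpperBound f s × (∀ b → IsUpperBound f b → s ≤ b)
  IsInf f s = IsLowerBound f s × (∀ b → IsLowerBound f b → b ≤ s)

-- The real numbers, by their categorical axioms: a Dedekind-complete ordered
-- field.  The inverse is total, with 0 ⁻¹ ≈ 0; since the carrier is a small
-- set, small families are the same as subsets in the completeness axiom.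
record CompleteOrderedField : Set₁ where
  infix  4 _≈_ _≤_
  infixl 6 _+_
  infixl 7 _*_
  infix  8 -_ _⁻¹
  field
    Carrier           : Set
    _≈_ _≤_           : Rel Carrier 0ℓ
    _+_ _*_           : Carrier → Carrier → Carrier
    -_ _⁻¹            : Carrier → Carrier
    0# 1#             : Carrier
    isCommutativeRing : IsCommutativeRing _≈_ _+_ _*_ -_ 0# 1#
    isTotalOrder      : IsTotalOrder _≈_ _≤_
    0≉1               : ¬ (0# ≈ 1#)
    *-inverseʳ        : ∀ {x} → ¬ (x ≈ 0#) → x * x ⁻¹ ≈ 1#
    zero⁻¹            : ∀ {x} → x ≈ 0# → x ⁻¹ ≈ 0#
    +-monoˡ-≤         : ∀ {x y} z → x ≤ y → x + z ≤ y + z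
    *-nonneg          : ∀ {x y} → 0# ≤ x → 0# ≤ y → 0# ≤ x * y
    complete          : {I : Set} (f : I → Carrier) → I →
                        ∃ (Bounds.IsUpperBound _≤_ f) → ∃ (Bounds.IsSup _≤_ f)

  commutativeRing : CommutativeRing 0ℓ 0ℓ
  commutativeRing = record { isCommutativeRing = isCommutativeRing }

  open Bounds _≤_ public
  open CommutativeRing commutativeRing public using (_-_)
  open NonStrictToStrict _≈_ _≤_ public using (_<_)
  open AddSupremum _≤_ public using (_≤⁺_)

  fromℕ : ℕ → Carrier
  fromℕ n = n ⋆ 1#
    where open RawMonoidDefs (CommutativeRing.+-rawMonoid commutativeRing)
            renaming (_×_ to _⋆_)

record Graph : Set₁ where
  infix 4 _~_
  field
    V        : Set
    _~_      : Rel V 0ℓ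
    ~-sym    : Symmetric _~_
    ~-irrefl : Irreflexive _≡_ _~_

  -- Each edge xy occurs in E in both orientations, (x , y) and (y , x).
  E : Set
  E = Σ V λ x → Σ V λ y → x ~ y

  data Walk : ℕ → V → V → Set where
    []  : ∀ {x} → Walk zero x x
    _∷_ : ∀ {n x y z} → x ~ y → Walk n y z → Walk (suc n) x z

  Connected : Set
  Connected = ∀ x y → ∃ λ n → Walk n x y

  -- k ≥ 3 is not imposed; only lengths 3, 4 and 5 are used.
  record Cycle (k : ℕ) .{{_ : NonZero k}} : Set where
    next : Fin k → Fin k
    next i = suc (toℕ i) mod k
    field
      vertex   : Fin k → V
      distinct : Injective _≡_ _≡_ vertex
      adjacent : ∀ i → vertex i ~ vertex (next i)

  LiesOn : ∀ {k} .{{_ : NonZero k}} → E → Cycle k → Set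
  LiesOn (x , y , _) c = ∃ λ i →
      (vertex i ≡ x × vertex (next i) ≡ y)
    ⊎ (vertex i ≡ y × vertex (next i) ≡ x)
    where open Cycle c

  TreeLike : E → Set
  TreeLike e = (¬ ∃ λ (c : Cycle 3) → LiesOn e c)
             × (¬ ∃ λ (c : Cycle 4) → LiesOn e c)
             × (¬ ∃ λ (c : Cycle 5) → LiesOn e c)

  E-tl : Set
  E-tl = Σ E TreeLike

  record LocallyFinite : Set where
    field
      nbrs        : V → List V
      nbrs-unique : ∀ x → Unique (nbrs x)
      ∈nbrs⇔~     : ∀ x {y} → (y ∈ nbrs x) ⇔ (x ~ y)

    degree : V → ℕ
    degree x = length (nbrs x)

-- The source works in classical mathematics; excluded middle is an explicit
-- parameter, and is what makes infima, square roots, distances, … total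
-- functions.
module ClassicalReals (lem : ExcludedMiddle 0ℓ) (ℝ : CompleteOrderedField) where
  open CompleteOrderedField ℝ

  -- Some real satisfying P, and 0 if there is none.
  the : (Carrier → Set) → Carrier
  the P with lem {∃ P}
  ... | yes (r , _) = r
  ... | no  _       = 0#

  inf : {I : Set} → (I → Carrier) → Carrier
  inf f = the (IsInf f)

  √ : Carrier → Carrier
  √ a = the λ r → 0# ≤ r × r * r ≈ a

  -- ⊤⁺ plays the role of +∞.  For a nonempty family, no real supremum exists
  -- exactly when the family is unbounded above.
  sup⁺ : {I : Set} → (I → Carrier) → Carrier ⁺
  sup⁺ f with lem {∃ (IsSup f)}
  ... | yes (s , _) = [ s ]
  ... | no  _       = ⊤⁺

  -- The limit of g(α) as α → 1⁻, for g considered on [0,1).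
  IsLimitAt1⁻ : (Carrier → Carrier) → Carrier → Set
  IsLimitAt1⁻ g k = ∀ ε → 0# < ε → ∃ λ δ → 0# < δ ×
    (∀ α → 0# ≤ α → α < 1# → 1# - δ < α → k - ε < g α × g α < k + ε)

module Curvature (lem : ExcludedMiddle 0ℓ) (ℝ : CompleteOrderedField)
                 (G : Graph) (lf : Graph.LocallyFinite G) where
  open CompleteOrderedField ℝ
  open ClassicalReals lem ℝ
  open Graph G
  open LocallyFinite lf

  -- Connectedness of G makes the second case impossible.
  d : V → V → ℕ
  d x y with lem {∃ λ n → Walk n x y × (∀ m → Walk m x y → n ℕ.≤ m)}
  ... | yes (n , _) = n
  ... | no  _       = 0

  ∑ : List V → (V → Carrier) → Carrier
  ∑ xs f = foldr _+_ 0# (map f xs)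

  record FinitelySupported : Set where
    field
      supp    : List V
      unique  : Unique supp
      mass    : V → Carrier
      outside : ∀ {z} → z ∉ supp → mass z ≈ 0#

  record Coupling (μ ν : FinitelySupported) : Set where
    private
      module μ = FinitelySupported μ
      module ν = FinitelySupported ν
    field
      plan         : V → V → Carrier
      nonneg       : ∀ u v → 0# ≤ plan u v
      concentrated : ∀ u v → u ∉ μ.supp ⊎ v ∉ ν.supp → plan u v ≈ 0#
      marginalˡ    : ∀ u → ∑ ν.supp (λ v → plan u v) ≈ μ.mass u
      marginalʳ    : ∀ v → ∑ μ.supp (λ u → plan u v) ≈ ν.mass v

    cost : Carrier
    cost = ∑ μ.supp λ u → ∑ ν.supp λ v → fromℕ (d u v) * plan u v

  W₁ : FinitelySupported → FinitelySupported → Carrier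
  W₁ μ ν = inf {Coupling μ ν} Coupling.cost

  -- Only the values of weight on adjacent pairs are ever used.
  record Weight : Set where
    field
      weight     : V → V → Carrier
      weight-sym : ∀ {x y} → x ~ y → weight x y ≈ weight y x
      weight-pos : ∀ {x y} → x ~ y → 0# < weight x y

    onEdge : E → Carrier
    onEdge (x , y , _) = weight x y

    wdegree : V → Carrier
    wdegree x = ∑ (nbrs x) (weight x)

    walkMass : Carrier → V → V → Carrier
    walkMass α x z with lem {z ≡ x} | lem {x ~ z}
    ... | yes _ | _     = α
    ... | no  _ | yes _ = (1# - α) * (weight x z * wdegree x ⁻¹)
    ... | no  _ | no  _ = 0#

    μ : Carrier → V → FinitelySupported
    μ α x = record
      { supp    = x ∷ nbrs x
      ; unique  = ¬Any⇒All¬ (nbrs x) (~-irrefl refl ∘ Equivalence.to (∈nbrs⇔~ x))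
                  ∷ nbrs-unique x
      ; mass    = walkMass α x
      ; outside = λ {z} → out z
      }
      where
      out : ∀ z → z ∉ x ∷ nbrs x → walkMass α x z ≈ 0#
      out z z∉ with lem {z ≡ x} | lem {x ~ z}
      ... | yes z≡x | _       = ⊥-elim (z∉ (here z≡x))
      ... | no  _   | yes x~z = ⊥-elim (z∉ (there (Equivalence.from (∈nbrs⇔~ x) x~z)))
      ... | no  _   | no  _   = CommutativeRing.refl commutativeRing

    κ : Carrier → V → V → Carrier
    κ α x y = 1# - W₁ (μ α x) (μ α y)

    IsLLYCurvature : V → V → Carrier → Set
    IsLLYCurvature x y = IsLimitAt1⁻ λ α → κ α x y * (1# - α) ⁻¹

    Admissible : Set
    Admissible = ∀ {x y} → x ~ y → ∃ λ k → IsLLYCurvature x y k × 0# ≤ k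

    Dist : Carrier ⁺
    Dist with sup⁺ onEdge | lem {inf onEdge ≈ 0#}
    ... | ⊤⁺    | _     = ⊤⁺
    ... | [ _ ] | yes _ = ⊤⁺
    ... | [ s ] | no  _ = [ s * inf onEdge ⁻¹ ]

  FiniteDistortion : Set
  FiniteDistortion = Σ Weight λ w → Weight.Admissible w × ∃ λ r → Weight.Dist w ≡ [ r ]

  distortion : FiniteDistortion → Carrier
  distortion (_ , _ , r , _) = r

  -- For graphs with at least one edge.
  DN-LLY : Carrier ⁺
  DN-LLY with lem {FiniteDistortion}
  ... | yes _ = [ inf distortion ]
  ... | no  _ = ⊤⁺

  degreeBound : E → Carrier
  degreeBound (x , y , _) = √ ((fromℕ (degree x) - 1#) * (fromℕ (degree y) - 1#))

{-# OPTIONS --safe #-}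

-- Let xy be tree-like.  The graph distance between the unit balls around x and
-- y is then realised along the edge xy, so on the ball around x the distance
-- from y is an optimal transport potential, and dually.  Testing with these
-- potentials gives, for every α < 1,
--   κ_α(x, y) / (1 − α) ≤ 2 (w_xy / d_x^w + w_xy / d_y^w − 1),
-- hence the same bound on the limit.  If that curvature is nonnegative, then
-- clearing denominators yields
--   (d_x^w − w_xy) (d_y^w − w_xy) ≤ w_xy²,
-- whose left side is at least (d_x − 1) (d_y − 1) (inf w)² and whose right side
-- is at most (sup w)².
module Submission where

open import Defs
open import Algebra.Bundles using (CommutativeRing)
open import Algebra.Solver.Ring.AlmostCommutativeRing
  using (fromCommutativeRing; _-Raw-AlmostCommutative⟶_; Induced-equivalence)
open import Axiom.ExcludedMiddle using (ExcludedMiddle)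
open import Data.Fin.Patterns using (0F; 1F; 2F; 3F; 4F)
open import Data.Integer.Base as ℤ using (ℤ; +_; -[1+_]; _⊖_; _◃_)
open import Data.List.Base using (List; []; _∷_; length)
open import Data.List.Membership.Propositional using (_∈_)
open import Data.List.Relation.Unary.All as All using ()
open import Data.List.Relation.Unary.AllPairs using ([]; _∷_)
open import Data.List.Relation.Unary.Any using (here; there)
open import Data.List.Relation.Unary.Unique.Propositional using (Unique)
open import Data.Maybe.Base using (just; nothing)
open import Data.Nat.Base as ℕ using (ℕ; zero; suc)
open import Data.Nat.Induction using (<-rec)
open import Data.Product.Base using (∃; _×_; _,_; proj₁; proj₂)
open import Data.Sign.Base as Sign using ()
open import Data.Sum.Base using (inj₁; inj₂)
open import Data.Vec.Base using (Vec; []; _∷_; lookup)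
open import Data.Vec.Relation.Unary.All using ([]; _∷_)
open import Data.Vec.Relation.Unary.AllPairs using ([]; _∷_)
open import Data.Vec.Relation.Unary.Unique.Propositional.Properties using (lookup-injective)
open import Function.Base using (_∘_; case_of_)
open import Function.Bundles using (Equivalence)
open import Level using (0ℓ)
open import Relation.Binary.Bundles using (Poset)
open import Relation.Binary.Definitions using (WeaklyDecidable)
open import Relation.Binary.PropositionalEquality.Core as ≡ using (_≡_)
open import Relation.Binary.Structures using (IsTotalOrder)
open import Relation.Nullary.Construct.Add.Supremum using ([_])
open import Relation.Nullary.Decidable.Core using (yes; no)
open import Relation.Nullary.Negation.Core using (¬_; contradiction)
import Algebra.Properties.Monoid.Mult as Mult
import Algebra.Properties.Ring as RingProperties
import Algebra.Properties.Semiring.Mult.TCOptimised as OptimisedMult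
import Algebra.Solver.Ring as RingSolver
import Data.Integer.Properties as ℤ
import Data.Nat.Properties as ℕ
import Relation.Binary.Construct.Add.Supremum.NonStrict as AddSupremum
import Relation.Binary.Reasoning.PartialOrder as PartialOrderReasoning
import Relation.Binary.Reasoning.Setoid as SetoidReasoning

-- Ring identities over integer coefficients

-- The library's ring solver needs coefficients with decidable equality, which
-- an abstract ring lacks: integer coefficients serve for every ring.
module IntegerCoefficientSolver (R : CommutativeRing 0ℓ 0ℓ) where
  open CommutativeRing R
  open OptimisedMult semiring
    using (×-homo-+; ×1-homo-*; 1+×) renaming (_×_ to _⋆_)
  open RingProperties ring
  open SetoidReasoning setoid

  -- With the optimised multiple, `fromℤ (+ 1)` reduces to `1#` and `fromℤ (+ 2)` to `1# + 1#`, so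
  -- solver constants agree by computation with the constants of later goals.
  fromℤ : ℤ → Carrier
  fromℤ (+ n)      = n ⋆ 1#
  fromℤ -[1+ n ]   = - (suc n ⋆ 1#)

  -- `◃` sends negative zero to `+ 0`, so zero is a case of its own.
  fromℤ-◃ : ∀ n → fromℤ (Sign.- ◃ n) ≈ - (n ⋆ 1#)
  fromℤ-◃ zero    = sym -0#≈0#
  fromℤ-◃ (suc n) = refl

  fromℤ-+◃ : ∀ n → fromℤ (Sign.+ ◃ n) ≈ n ⋆ 1#
  fromℤ-+◃ zero    = refl
  fromℤ-+◃ (suc n) = refl

  cancel-common : ∀ a b c → (a + b) - (a + c) ≈ b - c
  cancel-common a b c = begin
    (a + b) - (a + c)      ≈⟨ +-cong (+-comm a b) (sym (-‿+-comm a c)) ⟩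
    (b + a) + (- a + - c)  ≈⟨ +-assoc b a _ ⟩
    b + (a + (- a + - c))  ≈⟨ +-congˡ (sym (+-assoc a (- a) (- c))) ⟩
    b + ((a - a) - c)      ≈⟨ +-congˡ (+-congʳ (-‿inverseʳ a)) ⟩
    b + (0# - c)           ≈⟨ +-congˡ (+-identityˡ _) ⟩
    b - c                  ∎

  fromℤ-⊖ : ∀ m n → fromℤ (m ⊖ n) ≈ m ⋆ 1# - n ⋆ 1#
  fromℤ-⊖ m zero = sym (trans (+-congˡ -0#≈0#) (+-identityʳ _))
  fromℤ-⊖ zero (suc n) = sym (+-identityˡ _)
  fromℤ-⊖ (suc m) (suc n) = begin
    fromℤ (suc m ⊖ suc n)              ≡⟨ ≡.cong fromℤ (ℤ.[1+m]⊖[1+n]≡m⊖n m n) ⟩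
    fromℤ (m ⊖ n)                      ≈⟨ fromℤ-⊖ m n ⟩
    m ⋆ 1# - n ⋆ 1#                    ≈⟨ cancel-common 1# _ _ ⟨
    (1# + m ⋆ 1#) - (1# + n ⋆ 1#)      ≈⟨ +-cong (1+× m 1#) (-‿cong (1+× n 1#)) ⟨
    suc m ⋆ 1# - suc n ⋆ 1#            ∎

  fromℤ-+ : ∀ i j → fromℤ (i ℤ.+ j) ≈ fromℤ i + fromℤ j
  fromℤ-+ (+ m)    (+ n)    = ×-homo-+ 1# m n
  fromℤ-+ (+ m)    -[1+ n ] = fromℤ-⊖ m (suc n)
  fromℤ-+ -[1+ m ] (+ n)    = trans (fromℤ-⊖ n (suc m)) (+-comm _ _)
  fromℤ-+ -[1+ m ] -[1+ n ] = begin
    - (suc (suc (m ℕ.+ n)) ⋆ 1#)       ≡⟨ ≡.cong (λ k → - (suc k ⋆ 1#)) (ℕ.+-suc m n) ⟨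
    - ((suc m ℕ.+ suc n) ⋆ 1#)         ≈⟨ -‿cong (×-homo-+ 1# (suc m) (suc n)) ⟩
    - (suc m ⋆ 1# + suc n ⋆ 1#)        ≈⟨ -‿+-comm _ _ ⟨
    - (suc m ⋆ 1#) - suc n ⋆ 1#        ∎

  fromℤ-* : ∀ i j → fromℤ (i ℤ.* j) ≈ fromℤ i * fromℤ j
  fromℤ-* (+ m)    (+ n)    = trans (fromℤ-+◃ (m ℕ.* n)) (×1-homo-* m n)
  fromℤ-* (+ m)    -[1+ n ] =
    trans (fromℤ-◃ (m ℕ.* suc n)) (trans (-‿cong (×1-homo-* m (suc n))) (-‿distribʳ-* _ _))
  fromℤ-* -[1+ m ] (+ n)    =
    trans (fromℤ-◃ (suc m ℕ.* n)) (trans (-‿cong (×1-homo-* (suc m) n)) (-‿distribˡ-* _ _))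
  fromℤ-* -[1+ m ] -[1+ n ] = begin
    (suc m ℕ.* suc n) ⋆ 1#             ≈⟨ ×1-homo-* (suc m) (suc n) ⟩
    suc m ⋆ 1# * suc n ⋆ 1#            ≈⟨ -‿involutive _ ⟨
    - (- (suc m ⋆ 1# * suc n ⋆ 1#))    ≈⟨ -‿cong (-‿distribʳ-* _ _) ⟩
    - (suc m ⋆ 1# * - (suc n ⋆ 1#))    ≈⟨ -‿distribˡ-* _ _ ⟩
    - (suc m ⋆ 1#) * - (suc n ⋆ 1#)    ∎

  fromℤ-neg : ∀ i → fromℤ (ℤ.- i) ≈ - fromℤ i
  fromℤ-neg (+ zero)  = sym -0#≈0#
  fromℤ-neg (+ suc n) = refl
  fromℤ-neg -[1+ n ]  = sym (-‿involutive _)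

  morphism : ℤ.+-*-rawRing -Raw-AlmostCommutative⟶ fromCommutativeRing R
  morphism = record
    { ⟦_⟧    = fromℤ
    ; +-homo = fromℤ-+
    ; *-homo = fromℤ-*
    ; -‿homo = fromℤ-neg
    ; 0-homo = refl
    ; 1-homo = refl
    }

  -- Distinct integers can have equal images in positive characteristic, so unequal coefficients
  -- leave the question open.
  _≟_ : WeaklyDecidable (Induced-equivalence morphism)
  i ≟ j with i ℤ.≟ j
  ... | yes ≡.refl = just refl
  ... | no  _      = nothing

  open RingSolver ℤ.+-*-rawRing (fromCommutativeRing R) morphism _≟_ public

-- Order, inverses, infima and limits in a complete ordered field

module OrderedField (lem : ExcludedMiddle 0ℓ) (ℝ : CompleteOrderedField) where
  open CompleteOrderedField ℝ
  open ClassicalReals lem ℝ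
  open CommutativeRing commutativeRing
    using ( refl; sym; trans; +-congʳ; *-congˡ; *-congʳ; +-identityˡ
          ; *-identityˡ; *-identityʳ; zeroˡ; *-comm; *-assoc; +-monoid)
  open IntegerCoefficientSolver commutativeRing using (solve; con; _:+_; _:*_; _:-_; _:=_)
  open IsTotalOrder isTotalOrder using ()
    renaming (total to ≤-total; antisym to ≤-antisym; reflexive to ≤-reflexive; trans to ≤-trans)

  ≤-poset : Poset 0ℓ 0ℓ 0ℓ
  ≤-poset = record { isPartialOrder = IsTotalOrder.isPartialOrder isTotalOrder }

  open PartialOrderReasoning ≤-poset

  ≤⇒0≤- : ∀ {x y} → x ≤ y → 0# ≤ y - x
  ≤⇒0≤- {x} {y} x≤y = begin
    0#     ≈⟨ solve 1 (λ x → con (+ 0) := x :- x) refl x ⟩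
    x - x  ≤⟨ +-monoˡ-≤ (- x) x≤y ⟩
    y - x  ∎

  0≤-⇒≤ : ∀ {x y} → 0# ≤ y - x → x ≤ y
  0≤-⇒≤ {x} {y} 0≤y-x = begin
    x            ≈⟨ +-identityˡ x ⟨
    0# + x       ≤⟨ +-monoˡ-≤ x 0≤y-x ⟩
    (y - x) + x  ≈⟨ solve 2 (λ x y → (y :- x) :+ x := y) refl x y ⟩
    y            ∎

  -- Proof by certificate: a visibly nonnegative `t` and a ring identity that the solver can check.
  ≤-by : ∀ {x y t} → 0# ≤ t → t ≈ y - x → x ≤ y
  ≤-by 0≤t t≈y-x = 0≤-⇒≤ (≤-trans 0≤t (≤-reflexive t≈y-x))

  +-mono-≤ : ∀ {a b c d} → a ≤ b → c ≤ d → a + c ≤ b + d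
  +-mono-≤ {a} {b} {c} {d} a≤b c≤d = begin
    a + c  ≤⟨ +-monoˡ-≤ c a≤b ⟩
    b + c  ≈⟨ solve 2 (λ b c → b :+ c := c :+ b) refl b c ⟩
    c + b  ≤⟨ +-monoˡ-≤ b c≤d ⟩
    d + b  ≈⟨ solve 2 (λ d b → d :+ b := b :+ d) refl d b ⟩
    b + d  ∎

  +-nonneg : ∀ {x y} → 0# ≤ x → 0# ≤ y → 0# ≤ x + y
  +-nonneg {x} {y} 0≤x 0≤y = begin
    0#       ≈⟨ +-identityˡ 0# ⟨
    0# + 0#  ≤⟨ +-mono-≤ 0≤x 0≤y ⟩
    x + y    ∎

  *-monoʳ-≤ : ∀ {x y z} → 0# ≤ z → x ≤ y → x * z ≤ y * z
  *-monoʳ-≤ {x} {y} {z} 0≤z x≤y = ≤-by (*-nonneg (≤⇒0≤- x≤y) 0≤z)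
    (solve 3 (λ x y z → (y :- x) :* z := y :* z :- x :* z) refl x y z)

  *-mono-≤ : ∀ {a b c d} → 0# ≤ c → 0# ≤ b → a ≤ b → c ≤ d → a * c ≤ b * d
  *-mono-≤ {a} {b} {c} {d} 0≤c 0≤b a≤b c≤d = begin
    a * c  ≤⟨ *-monoʳ-≤ 0≤c a≤b ⟩
    b * c  ≈⟨ *-comm b c ⟩
    c * b  ≤⟨ *-monoʳ-≤ 0≤b c≤d ⟩
    d * b  ≈⟨ *-comm d b ⟩
    b * d  ∎

  square-nonneg : ∀ x → 0# ≤ x * x
  square-nonneg x with ≤-total 0# x
  ... | inj₁ 0≤x = *-nonneg 0≤x 0≤x
  ... | inj₂ x≤0 = begin
    0#                     ≤⟨ *-nonneg (≤⇒0≤- x≤0) (≤⇒0≤- x≤0) ⟩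
    (0# - x) * (0# - x)    ≈⟨ solve 1 (λ x → (con (+ 0) :- x) :* (con (+ 0) :- x) := x :* x) refl x ⟩
    x * x                  ∎

  0≤1 : 0# ≤ 1#
  0≤1 = ≤-trans (square-nonneg 1#) (≤-reflexive (*-identityˡ 1#))

  *-cancel⁻¹ : ∀ {x} y → ¬ x ≈ 0# → y * x * x ⁻¹ ≈ y
  *-cancel⁻¹ {x} y x≉0 = trans (*-assoc y x (x ⁻¹)) (trans (*-congˡ (*-inverseʳ x≉0)) (*-identityʳ y))

  -- A nonzero `x` has the inverse `x` times the square of `x ⁻¹`; at zero the convention `zero⁻¹`
  -- decides.
  ⁻¹-nonneg : ∀ {x} → 0# ≤ x → 0# ≤ x ⁻¹
  ⁻¹-nonneg {x} 0≤x with lem {x ≈ 0#}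
  ... | yes x≈0 = ≤-reflexive (sym (zero⁻¹ x≈0))
  ... | no  x≉0 = begin
    0#                    ≤⟨ *-nonneg 0≤x (square-nonneg (x ⁻¹)) ⟩
    x * (x ⁻¹ * x ⁻¹)     ≈⟨ solve 2 (λ x y → x :* (y :* y) := y :* x :* y) refl x (x ⁻¹) ⟩
    x ⁻¹ * x * x ⁻¹       ≈⟨ *-cancel⁻¹ (x ⁻¹) x≉0 ⟩
    x ⁻¹                  ∎

  square≈0⇒≈0 : ∀ {x} → x * x ≈ 0# → x ≈ 0#
  square≈0⇒≈0 {x} xx≈0 with lem {x ≈ 0#}
  ... | yes x≈0 = x≈0
  ... | no  x≉0 = trans (sym (*-cancel⁻¹ x x≉0)) (trans (*-congʳ xx≈0) (zeroˡ _))

  ≈-from-- : ∀ {x y} → x - y ≈ 0# → x ≈ y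
  ≈-from-- {x} {y} x-y≈0 = trans (solve 2 (λ x y → x := (x :- y) :+ y) refl x y)
    (trans (+-congʳ x-y≈0) (+-identityˡ y))

  -- If y ≤ x, then -(x - y)² = (y² - x²) + 2y(x - y) is a sum of nonnegative terms, which forces x
  -- = y.
  square-cancel-≤ : ∀ {x y} → 0# ≤ y → x * x ≤ y * y → x ≤ y
  square-cancel-≤ {x} {y} 0≤y xx≤yy with ≤-total x y
  ... | inj₁ x≤y = x≤y
  ... | inj₂ y≤x = ≤-reflexive (≈-from-- (square≈0⇒≈0 (≤-antisym upper (square-nonneg (x - y)))))
    where
    upper : (x - y) * (x - y) ≤ 0#
    upper = ≤-by (+-nonneg (≤⇒0≤- xx≤yy) (*-nonneg (+-nonneg 0≤y 0≤y) (≤⇒0≤- y≤x)))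
      (solve 2 (λ x y → (y :* y :- x :* x) :+ (y :+ y) :* (x :- y)
                        := con (+ 0) :- (x :- y) :* (x :- y)) refl x y)

  halve-nonneg : ∀ {x} → 0# ≤ x + x → 0# ≤ x
  halve-nonneg {x} 0≤x+x with ≤-total 0# x
  ... | inj₁ 0≤x = 0≤x
  ... | inj₂ x≤0 = ≤-trans 0≤x+x (≤-trans (+-monoˡ-≤ x x≤0) (≤-reflexive (+-identityˡ x)))

  fromℕ-mono-≤ : ∀ {m n} → m ℕ.≤ n → fromℕ m ≤ fromℕ n
  fromℕ-mono-≤ {n = n} ℕ.z≤n = fromℕ-nonneg n
    where
    fromℕ-nonneg : ∀ n → 0# ≤ fromℕ n
    fromℕ-nonneg zero    = ≤-reflexive refl
    fromℕ-nonneg (suc n) = +-nonneg 0≤1 (fromℕ-nonneg n)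
  fromℕ-mono-≤ (ℕ.s≤s m≤n) = +-mono-≤ (≤-reflexive refl) (fromℕ-mono-≤ m≤n)

  fromℕ-homo-+ : ∀ m n → fromℕ (m ℕ.+ n) ≈ fromℕ m + fromℕ n
  fromℕ-homo-+ = Mult.×-homo-+ +-monoid 1#

  the-satisfies : (P : Carrier → Set) → ∃ P → P (the P)
  the-satisfies P ∃P with lem {∃ P}
  ... | yes (_ , p) = p
  ... | no  ∄P      = contradiction ∃P ∄P

  -- Completeness provides suprema, so the infimum arises as the supremum of all lower bounds: `b`
  -- makes that family nonempty and `f i₀` bounds it from above.
  inf-isInf : {I : Set} (f : I → Carrier) {b : Carrier} → I → IsLowerBound f b → IsInf f (inf f)
  inf-isInf f {b} i₀ b-lower = the-satisfies (IsInf f) (s , s-lower , λ c c-lower → s-upper (c , c-lower))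
    where
    lowerBounds : ∃ (IsSup {∃ (IsLowerBound f)} proj₁)
    lowerBounds = complete proj₁ (b , b-lower) (f i₀ , λ (_ , c-lower) → c-lower i₀)
    s = proj₁ lowerBounds
    s-upper = proj₁ (proj₂ lowerBounds)
    s-lower : IsLowerBound f s
    s-lower i = proj₂ (proj₂ lowerBounds) (f i) (λ (_ , c-lower) → c-lower i)

  -- The point α = 1/(1+δ) lies in the left δ-neighbourhood of 1, as
  -- 1 − α = αδ and α − (1 − δ) = αδ².
  limit-≤ : ∀ {g k c} → IsLimitAt1⁻ g k → (∀ α → 0# ≤ α → α < 1# → g α ≤ c) → k ≤ c
  limit-≤ {g} {k} {c} g→k g≤c with ≤-total k c
  ... | inj₁ k≤c = k≤c
  ... | inj₂ c≤k with lem {k ≈ c}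
  ... | yes k≈c = ≤-reflexive k≈c
  -- With ε = k - c the limit condition reads c < g α near 1, against the assumed bound.
  ... | no  k≉c with g→k (k - c) (≤⇒0≤- c≤k , λ 0≈k-c → k≉c (≈-from-- (sym 0≈k-c)))
  ... | δ , (0≤δ , 0≉δ) , near = contradiction (≤-antisym (proj₁ c<gα) (g≤c α 0≤α α<1)) (proj₂ c<gα)
    where
    α : Carrier
    α = (1# + δ) ⁻¹
    1+δ≉0 : ¬ 1# + δ ≈ 0#
    1+δ≉0 1+δ≈0 = 0≉1 (≤-antisym 0≤1 (≤-by 0≤δ
      (trans (solve 1 (λ δ → δ := (con (+ 1) :+ δ) :- con (+ 1)) refl δ) (+-congʳ 1+δ≈0))))
    α[1+δ]≈1 : α * (1# + δ) ≈ 1#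
    α[1+δ]≈1 = trans (*-comm _ _) (*-inverseʳ 1+δ≉0)
    0≤α : 0# ≤ α
    0≤α = ⁻¹-nonneg (+-nonneg 0≤1 0≤δ)
    1-α≈αδ : α * δ ≈ 1# - α
    1-α≈αδ = trans (solve 2 (λ α δ → α :* δ := α :* (con (+ 1) :+ δ) :- α) refl α δ) (+-congʳ α[1+δ]≈1)
    α-[1-δ]≈αδδ : α * δ * δ ≈ α - (1# - δ)
    α-[1-δ]≈αδδ = begin-equality
      α * δ * δ                  ≈⟨ solve 2 (λ α δ → α :* δ :* δ
                                      := α :* (con (+ 1) :+ δ) :* (δ :- con (+ 1)) :+ α) refl α δ ⟩
      α * (1# + δ) * (δ - 1#) + α  ≈⟨ +-congʳ (*-congʳ α[1+δ]≈1) ⟩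
      1# * (δ - 1#) + α          ≈⟨ solve 2 (λ α δ → con (+ 1) :* (δ :- con (+ 1)) :+ α
                                      := α :- (con (+ 1) :- δ)) refl α δ ⟩
      α - (1# - δ)               ∎
    α≉0 : ¬ α ≈ 0#
    α≉0 α≈0 = 0≉1 (trans (sym (zeroˡ _)) (trans (*-congʳ (sym α≈0)) α[1+δ]≈1))
    *-cancel-α : ∀ {x} → α * x ≈ 0# → x ≈ 0#
    *-cancel-α {x} αx≈0 = trans (sym (*-cancel⁻¹ x α≉0)) (trans (*-congʳ (trans (*-comm _ _) αx≈0)) (zeroˡ _))
    x≈y⇒y-x≈0 : ∀ {x y} → x ≈ y → y - x ≈ 0#
    x≈y⇒y-x≈0 {x} x≈y = trans (+-congʳ (sym x≈y)) (solve 1 (λ x → x :- x := con (+ 0)) refl x)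
    α<1 : α < 1#
    α<1 = ≤-by (*-nonneg 0≤α 0≤δ) 1-α≈αδ
        , λ α≈1 → 0≉δ (sym (*-cancel-α (trans 1-α≈αδ (x≈y⇒y-x≈0 α≈1))))
    1-δ<α : 1# - δ < α
    1-δ<α = ≤-by (*-nonneg (*-nonneg 0≤α 0≤δ) 0≤δ) α-[1-δ]≈αδδ
          , λ eq → 0≉δ (sym (square≈0⇒≈0 (*-cancel-α
              (trans (sym (*-assoc α δ δ)) (trans α-[1-δ]≈αδδ (x≈y⇒y-x≈0 eq))))))
    k-[k-c]≈c : k - (k - c) ≈ c
    k-[k-c]≈c = solve 2 (λ k c → k :- (k :- c) := c) refl k c
    c<gα : c < g α
    c<gα with near α 0≤α α<1 1-δ<α
    ... | (≤gα , ≉gα) , _ = ≤-trans (≤-reflexive (sym k-[k-c]≈c)) ≤gα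
                          , λ c≈gα → ≉gα (trans k-[k-c]≈c c≈gα)

-- Finite sums over lists of vertices

module ListSums (lem : ExcludedMiddle 0ℓ) (ℝ : CompleteOrderedField)
                (G : Graph) (lf : Graph.LocallyFinite G) where
  open CompleteOrderedField ℝ
  open Graph G
  open Curvature lem ℝ G lf
  open OrderedField lem ℝ
  open CommutativeRing commutativeRing
    using ( refl; sym; trans; +-cong; +-congˡ; +-identityˡ
          ; +-identityʳ; *-identityˡ; zeroˡ; zeroʳ; distribˡ; distribʳ)
  open IntegerCoefficientSolver commutativeRing using (solve; _:+_; _:=_)
  open IsTotalOrder isTotalOrder using ()
    renaming (reflexive to ≤-reflexive; trans to ≤-trans)

  ∑-cong : ∀ xs {f g : V → Carrier} → (∀ {z} → z ∈ xs → f z ≈ g z) → ∑ xs f ≈ ∑ xs g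
  ∑-cong []       f≈g = refl
  ∑-cong (x ∷ xs) f≈g = +-cong (f≈g (here ≡.refl)) (∑-cong xs (f≈g ∘ there))

  ∑-mono : ∀ xs {f g : V → Carrier} → (∀ {z} → z ∈ xs → f z ≤ g z) → ∑ xs f ≤ ∑ xs g
  ∑-mono []       f≤g = ≤-reflexive refl
  ∑-mono (x ∷ xs) f≤g = +-mono-≤ (f≤g (here ≡.refl)) (∑-mono xs (f≤g ∘ there))

  ∑-zero : ∀ xs → ∑ xs (λ _ → 0#) ≈ 0#
  ∑-zero []       = refl
  ∑-zero (x ∷ xs) = trans (+-identityˡ _) (∑-zero xs)

  ∑-nonneg : ∀ xs {f : V → Carrier} → (∀ {z} → z ∈ xs → 0# ≤ f z) → 0# ≤ ∑ xs f
  ∑-nonneg xs 0≤f = ≤-trans (≤-reflexive (sym (∑-zero xs))) (∑-mono xs 0≤f)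

  ∑-+ : ∀ xs (f g : V → Carrier) → ∑ xs (λ z → f z + g z) ≈ ∑ xs f + ∑ xs g
  ∑-+ []       f g = sym (+-identityˡ 0#)
  ∑-+ (x ∷ xs) f g = trans (+-congˡ (∑-+ xs f g))
    (solve 4 (λ a b c d → (a :+ b) :+ (c :+ d) := (a :+ c) :+ (b :+ d)) refl _ _ _ _)

  ∑-*ˡ : ∀ xs c (f : V → Carrier) → ∑ xs (λ z → c * f z) ≈ c * ∑ xs f
  ∑-*ˡ []       c f = sym (zeroʳ c)
  ∑-*ˡ (x ∷ xs) c f = trans (+-congˡ (∑-*ˡ xs c f)) (sym (distribˡ c _ _))

  ∑-const : ∀ xs c → ∑ xs (λ _ → c) ≈ fromℕ (length xs) * c
  ∑-const []       c = sym (zeroˡ c)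
  ∑-const (x ∷ xs) c = trans (+-cong (sym (*-identityˡ c)) (∑-const xs c)) (sym (distribʳ c _ _))

  ∑-swap : ∀ xs ys (h : V → V → Carrier) →
           ∑ xs (λ u → ∑ ys (h u)) ≈ ∑ ys (λ v → ∑ xs (λ u → h u v))
  ∑-swap []       ys h = sym (∑-zero ys)
  ∑-swap (x ∷ xs) ys h = trans (+-congˡ (∑-swap xs ys h)) (sym (∑-+ ys _ _))

  ∑-vanishing : ∀ xs {f : V → Carrier} → (∀ {z} → z ∈ xs → f z ≈ 0#) → ∑ xs f ≈ 0#
  ∑-vanishing xs f≈0 = trans (∑-cong xs f≈0) (∑-zero xs)

  -- Uniqueness of the list ensures that `y` contributes exactly once.
  ∑-single : ∀ {xs y} {f : V → Carrier} → Unique xs → y ∈ xs →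
             (∀ {z} → z ∈ xs → ¬ z ≡ y → f z ≈ 0#) → ∑ xs f ≈ f y
  ∑-single {x ∷ xs} (x∉ ∷ _) (here ≡.refl) f≈0 =
    trans (+-congˡ (∑-vanishing xs (λ z∈ → f≈0 (there z∈) (λ z≡x → All.lookup x∉ z∈ (≡.sym z≡x)))))
          (+-identityʳ _)
  ∑-single {x ∷ xs} (x∉ ∷ u) (there y∈) f≈0 =
    trans (+-cong (f≈0 (here ≡.refl) (All.lookup x∉ y∈)) (∑-single u y∈ (f≈0 ∘ there)))
          (+-identityˡ _)

  term≤∑ : ∀ xs {y} {f : V → Carrier} → (∀ {z} → z ∈ xs → 0# ≤ f z) → y ∈ xs → f y ≤ ∑ xs f
  term≤∑ (x ∷ xs) 0≤f (here ≡.refl) =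
    ≤-trans (≤-reflexive (sym (+-identityʳ _))) (+-mono-≤ (≤-reflexive refl) (∑-nonneg xs (0≤f ∘ there)))
  term≤∑ (x ∷ xs) 0≤f (there y∈) =
    ≤-trans (≤-reflexive (sym (+-identityˡ _))) (+-mono-≤ (0≤f (here ≡.refl)) (term≤∑ xs (0≤f ∘ there) y∈))

-- Couplings and lower bounds on the Wasserstein distance

module Transport (lem : ExcludedMiddle 0ℓ) (ℝ : CompleteOrderedField)
                 (G : Graph) (lf : Graph.LocallyFinite G) where
  open CompleteOrderedField ℝ
  open Graph G
  open Curvature lem ℝ G lf
  open OrderedField lem ℝ
  open ListSums lem ℝ G lf
  open CommutativeRing commutativeRing
    using (sym; trans; +-cong; *-congˡ; *-congʳ; *-identityʳ; zeroˡ; zeroʳ; *-comm; distribʳ)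
  open PartialOrderReasoning ≤-poset
  open FinitelySupported using (supp; mass; outside)

  expectation : FinitelySupported → (V → Carrier) → Carrier
  expectation μ f = ∑ (supp μ) λ u → f u * mass μ u

  record IsProbability (μ : FinitelySupported) : Set where
    field
      mass-nonneg : ∀ u → 0# ≤ mass μ u
      total       : ∑ (supp μ) (mass μ) ≈ 1#

  open IsProbability

  -- The easy half of Kantorovich duality.
  expectations≤cost : ∀ {μ ν} (π : Coupling μ ν) (f g : V → Carrier) →
    (∀ {u v} → u ∈ supp μ → v ∈ supp ν → f u + g v ≤ fromℕ (d u v)) →
    expectation μ f + expectation ν g ≤ Coupling.cost π
  expectations≤cost {μ} {ν} π f g f+g≤d = begin
    expectation μ f + expectation ν g
      -- Each mass is replaced by a marginal of the plan; the second double sum then has its order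
      -- of summation exchanged.
      ≈⟨ +-cong (∑-cong xs (λ {u} _ → trans (*-congˡ (sym (marginalˡ u))) (sym (∑-*ˡ ys (f u) (plan u)))))
                (trans (∑-cong ys (λ {v} _ → trans (*-congˡ (sym (marginalʳ v))) (sym (∑-*ˡ xs (g v) (λ u → plan u v)))))
                       (∑-swap ys xs (λ v u → g v * plan u v))) ⟩
    ∑ xs (λ u → ∑ ys λ v → f u * plan u v) + ∑ xs (λ u → ∑ ys λ v → g v * plan u v)
      ≈⟨ ∑-+ xs _ _ ⟨
    ∑ xs (λ u → ∑ ys (λ v → f u * plan u v) + ∑ ys (λ v → g v * plan u v))
      ≈⟨ ∑-cong xs (λ _ → trans (sym (∑-+ ys _ _)) (∑-cong ys (λ _ → sym (distribʳ _ _ _)))) ⟩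
    ∑ xs (λ u → ∑ ys λ v → (f u + g v) * plan u v)
      ≤⟨ ∑-mono xs (λ u∈ → ∑-mono ys (λ v∈ → *-monoʳ-≤ (nonneg _ _) (f+g≤d u∈ v∈))) ⟩
    cost ∎
    where
    open Coupling π
    xs = supp μ
    ys = supp ν

  -- This makes the family of costs nonempty, so that `W₁` is a genuine infimum and not the default
  -- 0 of `the`.
  independentCoupling : ∀ {μ ν} → IsProbability μ → IsProbability ν → Coupling μ ν
  independentCoupling {μ} {ν} μ-prob ν-prob = record
    { plan         = λ u v → mass μ u * mass ν v
    ; nonneg       = λ u v → *-nonneg (mass-nonneg μ-prob u) (mass-nonneg ν-prob v)
    ; concentrated = λ where
        u v (inj₁ u∉) → trans (*-congʳ (outside μ u∉)) (zeroˡ _)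
        u v (inj₂ v∉) → trans (*-congˡ (outside ν v∉)) (zeroʳ _)
    ; marginalˡ    = λ u → trans (∑-*ˡ (supp ν) _ _) (trans (*-congˡ (total ν-prob)) (*-identityʳ _))
    ; marginalʳ    = λ v → trans (∑-cong (supp μ) (λ _ → *-comm _ _))
        (trans (∑-*ˡ (supp μ) _ _) (trans (*-congˡ (total μ-prob)) (*-identityʳ _)))
    }

  -- Duality bounds every cost from below, and the infimum is the greatest such bound. The
  -- constraint on `f` and `g` is confined to the supports, because potentials that live on unit
  -- balls can be controlled only there.
  expectations≤W₁ : ∀ {μ ν} → IsProbability μ → IsProbability ν → (f g : V → Carrier) →
    (∀ {u v} → u ∈ supp μ → v ∈ supp ν → f u + g v ≤ fromℕ (d u v)) →
    expectation μ f + expectation ν g ≤ W₁ μ ν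
  expectations≤W₁ μ-prob ν-prob f g f+g≤d = proj₂ isInf _ lower
    where
    lower : IsLowerBound Coupling.cost _
    lower π = expectations≤cost π f g f+g≤d
    isInf = inf-isInf Coupling.cost (independentCoupling μ-prob ν-prob) lower

-- Shortest walks in a connected graph

module Distance (lem : ExcludedMiddle 0ℓ) (ℝ : CompleteOrderedField)
                (G : Graph) (connected : Graph.Connected G) (lf : Graph.LocallyFinite G) where
  open Graph G
  open Curvature lem ℝ G lf using (d)

  Geodesic : ℕ → V → V → Set
  Geodesic n x y = Walk n x y × (∀ m → Walk m x y → n ℕ.≤ m)

  -- Well-founded descent on the length: excluded middle either yields a strictly shorter walk or
  -- certifies the present one as minimal.
  geodesic-exists : ∀ {x y} n → Walk n x y → ∃ λ k → Geodesic k x y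
  geodesic-exists {x} {y} = <-rec _ λ n shorter p → case lem {∃ λ m → m ℕ.< n × Walk m x y} of λ where
    (yes (_ , m<n , q)) → shorter m<n q
    (no  ∄shorter)      → n , p , λ m q → ℕ.≮⇒≥ (λ m<n → ∄shorter (m , m<n , q))

  -- Connectedness rules out the default branch of `d`. Any lower bound on the lengths of all walks
  -- from `x` to `y` then applies to `d x y`.
  d-walk : ∀ x y → Walk (d x y) x y
  d-walk x y with lem {∃ λ n → Geodesic n x y}
  ... | yes (_ , p , _) = p
  ... | no  ∄geodesic   = contradiction (geodesic-exists _ (proj₂ (connected x y))) ∄geodesic

-- Short cycles through a tree-like edge

module TreeLikeEdges (G : Graph) where
  open Graph G

  ~⇒≢ : ∀ {x y} → x ~ y → ¬ x ≡ y
  ~⇒≢ x~y x≡y = ~-irrefl x≡y x~y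

  ≢-sym : ∀ {x y : V} → ¬ x ≡ y → ¬ y ≡ x
  ≢-sym x≢y y≡x = x≢y (≡.sym y≡x)

  module _ {x y} (x~y : x ~ y) (tl : TreeLike (x , y , x~y)) where

    no-triangle : ∀ {z} → x ~ z → ¬ y ~ z
    no-triangle {z} x~z y~z = proj₁ tl (record
      { vertex   = lookup vs
      ; distinct = lookup-injective
          ((~⇒≢ x~y ∷ ~⇒≢ x~z ∷ []) ∷ (~⇒≢ y~z ∷ []) ∷ [] ∷ []) _ _
      ; adjacent = λ { 0F → x~y ; 1F → y~z ; 2F → ~-sym x~z }
      } , 0F , inj₁ (≡.refl , ≡.refl))
      where
      vs : Vec V 3
      vs = x ∷ y ∷ z ∷ []

    -- The two inequalities keep the closed walk x, y, v, u from degenerating; its other vertices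
    -- differ because they are adjacent.
    no-square : ∀ {u v} → x ~ u → y ~ v → ¬ u ≡ y → ¬ v ≡ x → ¬ u ~ v
    no-square {u} {v} x~u y~v u≢y v≢x u~v = proj₁ (proj₂ tl) (record
      { vertex   = lookup vs
      ; distinct = lookup-injective
          ( (~⇒≢ x~y ∷ ≢-sym v≢x ∷ ~⇒≢ x~u ∷ [])
          ∷ (~⇒≢ y~v ∷ ≢-sym u≢y ∷ [])
          ∷ (≢-sym (~⇒≢ u~v) ∷ [])
          ∷ [] ∷ []) _ _
      ; adjacent = λ { 0F → x~y ; 1F → y~v ; 2F → ~-sym u~v ; 3F → ~-sym x~u }
      } , 0F , inj₁ (≡.refl , ≡.refl))
      where
      vs : Vec V 4
      vs = x ∷ y ∷ v ∷ u ∷ []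

    -- The closed walk x, y, v, t, u is a cycle: t = x, t = y and u = v would each produce a
    -- triangle on the edge xy.
    no-pentagon : ∀ {u t v} → x ~ u → y ~ v → ¬ u ≡ y → ¬ v ≡ x → u ~ t → ¬ t ~ v
    no-pentagon {u} {t} {v} x~u y~v u≢y v≢x u~t t~v = proj₂ (proj₂ tl) (record
      { vertex   = lookup vs
      ; distinct = lookup-injective
          ( (~⇒≢ x~y ∷ ≢-sym v≢x ∷ ≢-sym t≢x ∷ ~⇒≢ x~u ∷ [])
          ∷ (~⇒≢ y~v ∷ ≢-sym t≢y ∷ ≢-sym u≢y ∷ [])
          ∷ (≢-sym (~⇒≢ t~v) ∷ ≢-sym u≢v ∷ [])
          ∷ (≢-sym (~⇒≢ u~t) ∷ [])
          ∷ [] ∷ []) _ _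
      ; adjacent = λ { 0F → x~y ; 1F → y~v ; 2F → ~-sym t~v ; 3F → ~-sym u~t ; 4F → ~-sym x~u }
      } , 0F , inj₁ (≡.refl , ≡.refl))
      where
      vs : Vec V 5
      vs = x ∷ y ∷ v ∷ t ∷ u ∷ []
      t≢x : ¬ t ≡ x
      t≢x ≡.refl = no-triangle t~v y~v
      t≢y : ¬ t ≡ y
      t≢y ≡.refl = no-triangle x~u (~-sym u~t)
      u≢v : ¬ u ≡ v
      u≢v ≡.refl = no-triangle x~u y~v

-- Distance potentials around a tree-like edge

-- A potential for the transport problem along an edge xy: the distance from y
-- on the ball around x, when the edge is tree-like.
module Potential (lem : ExcludedMiddle 0ℓ) (ℝ : CompleteOrderedField)
                 (G : Graph) (connected : Graph.Connected G) (lf : Graph.LocallyFinite G) where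
  open Graph G
  open LocallyFinite lf
  open Curvature lem ℝ G lf using (d)
  open Distance lem ℝ G connected lf
  open TreeLikeEdges G

  ρ : V → V → V → ℕ
  ρ x y u with lem {u ≡ y} | lem {u ≡ x}
  ... | yes _ | _     = 0
  ... | no  _ | yes _ = 1
  ... | no  _ | no  _ = 2

  ρ-far : ∀ x {y} → ρ x y y ≡ 0
  ρ-far x {y} with lem {y ≡ y}
  ... | yes _   = ≡.refl
  ... | no  y≢y = contradiction ≡.refl y≢y

  ρ-centre : ∀ {x y} → ¬ x ≡ y → ρ x y x ≡ 1
  ρ-centre {x} {y} x≢y with lem {x ≡ y} | lem {x ≡ x}
  ... | yes x≡y | _       = contradiction x≡y x≢y
  ... | no  _   | yes _   = ≡.refl
  ... | no  _   | no  x≢x = contradiction ≡.refl x≢x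

  ρ-other : ∀ {x y u} → ¬ u ≡ y → ¬ u ≡ x → ρ x y u ≡ 2
  ρ-other {x} {y} {u} u≢y u≢x with lem {u ≡ y} | lem {u ≡ x}
  ... | yes u≡y | _       = contradiction u≡y u≢y
  ... | no  _   | yes u≡x = contradiction u≡x u≢x
  ... | no  _   | no  _   = ≡.refl

  ∈ball : ∀ {x u} → u ∈ x ∷ nbrs x → ¬ u ≡ x → x ~ u
  ∈ball (here u≡x)  u≢x = contradiction u≡x u≢x
  ∈ball (there u∈x) _   = Equivalence.to (∈nbrs⇔~ _) u∈x

  1≤length : ∀ {n u v} → Walk n u v → ¬ u ≡ v → 1 ℕ.≤ n
  1≤length []      u≢u = contradiction ≡.refl u≢u
  1≤length (_ ∷ _) _   = ℕ.s≤s ℕ.z≤n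

  2≤length : ∀ {n u v} → Walk n u v → ¬ u ≡ v → ¬ u ~ v → 2 ℕ.≤ n
  2≤length []          u≢u _   = contradiction ≡.refl u≢u
  2≤length (u~v ∷ [])  _   u≁v = contradiction u~v u≁v
  2≤length (_ ∷ _ ∷ _) _   _   = ℕ.s≤s (ℕ.s≤s ℕ.z≤n)

  3≤length : ∀ {n u v} → Walk n u v → ¬ u ≡ v → ¬ u ~ v → (∀ {t} → u ~ t → ¬ t ~ v) → 3 ℕ.≤ n
  3≤length []                  u≢u _   _    = contradiction ≡.refl u≢u
  3≤length (u~v ∷ [])          _   u≁v _    = contradiction u~v u≁v
  3≤length (u~t ∷ t~v ∷ [])    _   _   far  = contradiction t~v (far u~t)
  3≤length (_ ∷ _ ∷ _ ∷ _)     _   _   _    = ℕ.s≤s (ℕ.s≤s (ℕ.s≤s ℕ.z≤n))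

  -- Transport from `u` to `v` can do no better than pass through xy, since a shortcut would close a
  -- cycle of length 3, 4 or 5. The summand 1 pays for the edge xy, which both potentials count.
  ρ+ρ≤1+d : ∀ {x y} (x~y : x ~ y) → TreeLike (x , y , x~y) →
            ∀ {u v} → u ∈ x ∷ nbrs x → v ∈ y ∷ nbrs y → ρ x y u ℕ.+ ρ y x v ℕ.≤ 1 ℕ.+ d u v
  ρ+ρ≤1+d {x} {y} x~y tl {u} {v} u∈ v∈
    -- These are the decisions made inside `ρ x y u` and `ρ y x v`, so both values compute in every
    -- branch.
    with lem {u ≡ y} | lem {u ≡ x} | lem {v ≡ x} | lem {v ≡ y} | d-walk u v
  ... | yes _      | _          | yes _      | _          | _ = ℕ.z≤n
  ... | yes _      | _          | no _       | yes _      | _ = ℕ.s≤s ℕ.z≤n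
  ... | yes ≡.refl | _          | no _       | no v≢y     | p = ℕ.s≤s (1≤length p (≢-sym v≢y))
  ... | no _       | yes _      | yes _      | _          | _ = ℕ.s≤s ℕ.z≤n
  ... | no u≢y     | yes ≡.refl | no _       | yes ≡.refl | p = ℕ.s≤s (1≤length p u≢y)
  ... | no _       | yes ≡.refl | no v≢x     | no v≢y     | p =
    ℕ.s≤s (2≤length p (≢-sym v≢x) (λ x~v → no-triangle x~y tl x~v (∈ball v∈ v≢y)))
  ... | no _       | no u≢x     | yes ≡.refl | _          | p = ℕ.s≤s (1≤length p u≢x)
  ... | no u≢y     | no u≢x     | no _       | yes ≡.refl | p =
    ℕ.s≤s (2≤length p u≢y (λ u~y → no-triangle x~y tl (∈ball u∈ u≢x) (~-sym u~y)))
  ... | no u≢y     | no u≢x     | no v≢x     | no v≢y     | p =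
    -- Walks of length 0, 1 and 2 would close a triangle, a square and a pentagon, respectively.
    ℕ.s≤s (3≤length p
      (λ { ≡.refl → no-triangle x~y tl x~u y~v })
      (no-square x~y tl x~u y~v u≢y v≢x)
      (no-pentagon x~y tl x~u y~v u≢y v≢x))
    where
    x~u = ∈ball u∈ u≢x
    y~v = ∈ball v∈ v≢y

-- Curvature of a tree-like edge and the resulting weight inequality

module CurvatureBound (lem : ExcludedMiddle 0ℓ) (ℝ : CompleteOrderedField)
                      (G : Graph) (connected : Graph.Connected G) (lf : Graph.LocallyFinite G)
                      (w : Curvature.Weight lem ℝ G lf) where
  open CompleteOrderedField ℝ
  open Graph G
  open LocallyFinite lf
  open Curvature lem ℝ G lf
  open Weight w
  open OrderedField lem ℝ
  open ListSums lem ℝ G lf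
  open Transport lem ℝ G lf
  open Potential lem ℝ G connected lf
  open TreeLikeEdges G
  open CommutativeRing commutativeRing
    using ( refl; sym; trans; +-cong; +-congˡ; +-congʳ; *-cong
          ; *-congˡ; *-congʳ; *-identityʳ; *-comm; distribʳ; -‿cong)
  open IntegerCoefficientSolver commutativeRing using (solve; con; _:+_; _:*_; _:-_; :-_; _:=_)
  open IsTotalOrder isTotalOrder using ()
    renaming (trans to ≤-trans; reflexive to ≤-reflexive; antisym to ≤-antisym)
  open PartialOrderReasoning ≤-poset

  ∈nbrs : ∀ {x z} → x ~ z → z ∈ nbrs x
  ∈nbrs = Equivalence.from (∈nbrs⇔~ _)

  nbrs⇒~ : ∀ {x z} → z ∈ nbrs x → x ~ z
  nbrs⇒~ = Equivalence.to (∈nbrs⇔~ _)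

  -- For adjacent vertices, the jump probability of the walk without laziness.
  share : V → V → Carrier
  share x z = weight x z * wdegree x ⁻¹

  walkMass-centre : ∀ α x → walkMass α x x ≈ α
  walkMass-centre α x with lem {x ≡ x} | lem {x ~ x}
  ... | yes _   | _ = refl
  ... | no  x≢x | _ = contradiction ≡.refl x≢x

  walkMass-nbr : ∀ α {x z} → x ~ z → walkMass α x z ≈ (1# - α) * share x z
  walkMass-nbr α {x} {z} x~z with lem {z ≡ x} | lem {x ~ z}
  ... | yes z≡x | _       = contradiction (≡.sym z≡x) (~⇒≢ x~z)
  ... | no  _   | yes _   = refl
  ... | no  _   | no  x≁z = contradiction x~z x≁z

  weight-nonneg : ∀ {x z} → z ∈ nbrs x → 0# ≤ weight x z
  weight-nonneg z∈ = proj₁ (weight-pos (nbrs⇒~ z∈))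

  wdegree-nonneg : ∀ x → 0# ≤ wdegree x
  wdegree-nonneg x = ∑-nonneg (nbrs x) weight-nonneg

  wdegree≉0 : ∀ {x y} → x ~ y → ¬ wdegree x ≈ 0#
  wdegree≉0 {x} {y} x~y D≈0 = proj₂ (weight-pos x~y) (≤-antisym (proj₁ (weight-pos x~y))
    (≤-trans (term≤∑ (nbrs x) weight-nonneg (∈nbrs x~y)) (≤-reflexive D≈0)))

  ∑-share : ∀ {x y} → x ~ y → ∑ (nbrs x) (share x) ≈ 1#
  ∑-share {x} x~y = begin-equality
    ∑ (nbrs x) (share x)                          ≈⟨ ∑-cong (nbrs x) (λ _ → *-comm _ _) ⟩
    ∑ (nbrs x) (λ z → wdegree x ⁻¹ * weight x z)  ≈⟨ ∑-*ˡ (nbrs x) _ _ ⟩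
    wdegree x ⁻¹ * wdegree x                      ≈⟨ *-comm _ _ ⟩
    wdegree x * wdegree x ⁻¹                      ≈⟨ *-inverseʳ (wdegree≉0 x~y) ⟩
    1#                                            ∎

  ∑-walkMass-nbrs : ∀ α {x y} → x ~ y → ∑ (nbrs x) (walkMass α x) ≈ 1# - α
  ∑-walkMass-nbrs α {x} x~y = begin-equality
    ∑ (nbrs x) (walkMass α x)                   ≈⟨ ∑-cong (nbrs x) (λ z∈ → walkMass-nbr α (nbrs⇒~ z∈)) ⟩
    ∑ (nbrs x) (λ z → (1# - α) * share x z)     ≈⟨ ∑-*ˡ (nbrs x) _ _ ⟩
    (1# - α) * ∑ (nbrs x) (share x)             ≈⟨ *-congˡ (∑-share x~y) ⟩
    (1# - α) * 1#                               ≈⟨ *-identityʳ _ ⟩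
    1# - α                                      ∎

  -- The neighbour `y` makes the weighted degree nonzero; at an isolated vertex the mass 1 - α would
  -- be missing.
  μ-isProbability : ∀ {α x y} → 0# ≤ α → α ≤ 1# → x ~ y → IsProbability (μ α x)
  μ-isProbability {α} {x} 0≤α α≤1 x~y = record
    { mass-nonneg = walkMass-nonneg
    ; total       = begin-equality
        walkMass α x x + ∑ (nbrs x) (walkMass α x)  ≈⟨ +-cong (walkMass-centre α x) (∑-walkMass-nbrs α x~y) ⟩
        α + (1# - α)                                ≈⟨ solve 1 (λ α → α :+ (con (+ 1) :- α) := con (+ 1)) refl α ⟩
        1#                                          ∎
    }
    where
    walkMass-nonneg : ∀ z → 0# ≤ walkMass α x z
    walkMass-nonneg z with lem {z ≡ x} | lem {x ~ z}
    ... | yes _ | _       = 0≤α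
    ... | no  _ | yes x~z = *-nonneg (≤⇒0≤- α≤1)
            (*-nonneg (proj₁ (weight-pos x~z)) (⁻¹-nonneg (wdegree-nonneg x)))
    ... | no  _ | no  _   = ≤-reflexive refl

  -- The centre contributes α. If all neighbours had potential 2, they would contribute 2(1 - α);
  -- `deficit` measures the shortfall from this, and it is concentrated at `y`, where the potential
  -- is 0.
  expectation-ρ : ∀ α {x y} → x ~ y → expectation (μ α x) (fromℕ ∘ ρ x y) ≈
                  α + (1# - α) * ((1# - share x y) + (1# - share x y))
  expectation-ρ α {x} {y} x~y = begin-equality
    fromℕ (ρ x y x) * m x + ∑ (nbrs x) (λ z → fromℕ (ρ x y z) * m z)
      ≈⟨ +-cong centre (solve 2 (λ s t → s := (s :+ t) :- t) refl _ (∑ (nbrs x) deficit)) ⟩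
    α + ((∑ (nbrs x) (λ z → fromℕ (ρ x y z) * m z) + ∑ (nbrs x) deficit) - ∑ (nbrs x) deficit)
      ≈⟨ +-congˡ (+-cong (trans (sym (∑-+ (nbrs x) _ _)) without-deficit) (-‿cong deficit-at-y)) ⟩
    α + (2ℝ * (1# - α) - 2ℝ * ((1# - α) * share x y))
      ≈⟨ +-congˡ (solve 2 (λ β p → con (+ 2) :* β :- con (+ 2) :* (β :* p)
           := β :* ((con (+ 1) :- p) :+ (con (+ 1) :- p))) refl (1# - α) (share x y)) ⟩
    α + (1# - α) * ((1# - share x y) + (1# - share x y)) ∎
    where
    2ℝ : Carrier
    2ℝ = 1# + 1#
    m deficit : V → Carrier
    m = walkMass α x
    deficit z = (2ℝ - fromℕ (ρ x y z)) * m z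
    centre : fromℕ (ρ x y x) * m x ≈ α
    -- `fromℕ 1` unfolds to `1# + 0#`, whence the added zero in the solver term.
    centre rewrite ρ-centre (~⇒≢ x~y) = trans
      (solve 1 (λ a → (con (+ 1) :+ con (+ 0)) :* a := a) refl _) (walkMass-centre α x)
    without-deficit : ∑ (nbrs x) (λ z → fromℕ (ρ x y z) * m z + deficit z) ≈ 2ℝ * (1# - α)
    without-deficit = begin-equality
      ∑ (nbrs x) (λ z → fromℕ (ρ x y z) * m z + deficit z)
        ≈⟨ ∑-cong (nbrs x) (λ _ → solve 3 (λ t r a → r :* a :+ (t :- r) :* a := t :* a) refl _ _ _) ⟩
      ∑ (nbrs x) (λ z → 2ℝ * m z)      ≈⟨ ∑-*ˡ (nbrs x) _ _ ⟩
      2ℝ * ∑ (nbrs x) m                ≈⟨ *-congˡ (∑-walkMass-nbrs α x~y) ⟩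
      2ℝ * (1# - α)                    ∎
    deficit-vanishes : ∀ {z} → z ∈ nbrs x → ¬ z ≡ y → deficit z ≈ 0#
    deficit-vanishes {z} z∈ z≢y rewrite ρ-other {x} {y} z≢y (≢-sym (~⇒≢ (nbrs⇒~ z∈))) =
      solve 1 (λ a → (con (+ 2) :- (con (+ 1) :+ (con (+ 1) :+ con (+ 0)))) :* a := con (+ 0)) refl _
    deficit-at-y : ∑ (nbrs x) deficit ≈ 2ℝ * ((1# - α) * share x y)
    deficit-at-y = trans (∑-single (nbrs-unique x) (∈nbrs x~y) deficit-vanishes) at-y
      where
      at-y : deficit y ≈ 2ℝ * ((1# - α) * share x y)
      at-y rewrite ρ-far x {y} = trans
        (solve 2 (λ t a → (t :- con (+ 0)) :* a := t :* a) refl _ _) (*-congˡ (walkMass-nbr α x~y))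

  -- Half of the curvature bound of a tree-like edge; the final argument uses only its sign.
  shareExcess : V → V → Carrier
  shareExcess x y = share x y + share y x - 1#

  -- Writing p and q for the two shares, the potentials give W₁ ≥ 2α + 2(1 - α)(2 - p - q) - 1.
  -- Subtracting this from 1 leaves the exact factor 1 - α.
  κ-≤ : ∀ {α x y} (x~y : x ~ y) → TreeLike (x , y , x~y) → 0# ≤ α → α ≤ 1# →
        κ α x y ≤ (shareExcess x y + shareExcess x y) * (1# - α)
  κ-≤ {α} {x} {y} x~y tl 0≤α α≤1 = ≤-by (≤⇒0≤- expectations≤W)
    (solve 4 (λ α p q W →
      W :- ( (α :+ (con (+ 1) :- α) :* ((con (+ 1) :- p) :+ (con (+ 1) :- p)))
          :+ ((α :+ (con (+ 1) :- α) :* ((con (+ 1) :- q) :+ (con (+ 1) :- q))) :+ (:- con (+ 1))))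
      := ((p :+ q :- con (+ 1)) :+ (p :+ q :- con (+ 1))) :* (con (+ 1) :- α) :- (con (+ 1) :- W))
      refl α (share x y) (share y x) (W₁ (μ α x) (μ α y)))
    where
    y~x = ~-sym x~y
    μx-prob = μ-isProbability 0≤α α≤1 x~y
    μy-prob = μ-isProbability 0≤α α≤1 y~x
    f g : V → Carrier
    f = fromℕ ∘ ρ x y
    -- The constant -1 undoes the double count of xy in `ρ+ρ≤1+d`.
    g v = fromℕ (ρ y x v) + - 1#
    f+g≤d : ∀ {u v} → u ∈ x ∷ nbrs x → v ∈ y ∷ nbrs y → f u + g v ≤ fromℕ (d u v)
    f+g≤d {u} {v} u∈ v∈ = ≤-by (≤⇒0≤- (fromℕ-mono-≤ (ρ+ρ≤1+d x~y tl u∈ v∈)))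
      (trans (+-congˡ (-‿cong (fromℕ-homo-+ (ρ x y u) (ρ y x v))))
        (solve 3 (λ a b c → (con (+ 1) :+ c) :- (a :+ b) := c :- (a :+ (b :+ (:- con (+ 1))))) refl _ _ _))
    expectation-g : expectation (μ α y) g ≈
      (α + (1# - α) * ((1# - share y x) + (1# - share y x))) + - 1#
    expectation-g = begin-equality
      expectation (μ α y) g
        ≈⟨ trans (∑-cong (y ∷ nbrs y) (λ _ → distribʳ _ _ _)) (∑-+ (y ∷ nbrs y) _ _) ⟩
      expectation (μ α y) (fromℕ ∘ ρ y x) + expectation (μ α y) (λ _ → - 1#)
        ≈⟨ +-cong (expectation-ρ α y~x)
                  (trans (∑-*ˡ (y ∷ nbrs y) _ _) (trans (*-congˡ (IsProbability.total μy-prob)) (*-identityʳ _))) ⟩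
      (α + (1# - α) * ((1# - share y x) + (1# - share y x))) + - 1# ∎
    expectations≤W : (α + (1# - α) * ((1# - share x y) + (1# - share x y)))
                   + ((α + (1# - α) * ((1# - share y x) + (1# - share y x))) + - 1#)
                   ≤ W₁ (μ α x) (μ α y)
    expectations≤W = begin
      _                                                ≈⟨ +-cong (expectation-ρ α x~y) expectation-g ⟨
      expectation (μ α x) f + expectation (μ α y) g    ≤⟨ expectations≤W₁ μx-prob μy-prob f g f+g≤d ⟩
      W₁ (μ α x) (μ α y)                               ∎

  -- The factor 1 - α in `κ-≤` cancels, so the quotient has a bound independent of α, which survives
  -- the limit.
  LLY-≤ : ∀ {x y k} (x~y : x ~ y) → TreeLike (x , y , x~y) → IsLLYCurvature x y k →
          k ≤ shareExcess x y + shareExcess x y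
  LLY-≤ {x} {y} x~y tl limit = limit-≤ limit λ α 0≤α (α≤1 , α≉1) → begin
    κ α x y * (1# - α) ⁻¹
      ≤⟨ *-monoʳ-≤ (⁻¹-nonneg (≤⇒0≤- α≤1)) (κ-≤ x~y tl 0≤α α≤1) ⟩
    (shareExcess x y + shareExcess x y) * (1# - α) * (1# - α) ⁻¹
      ≈⟨ *-cancel⁻¹ _ (λ 1-α≈0 → α≉1 (sym (≈-from-- 1-α≈0))) ⟩
    shareExcess x y + shareExcess x y ∎

  otherWeight : V → V → Carrier
  otherWeight x y = wdegree x - weight x y

  -- Multiplied by both weighted degrees, the nonnegative excess becomes w·Dy + w·Dx - Dx·Dy, which
  -- equals w² - (Dx - w)(Dy - w).
  otherWeights-≤ : ∀ {x y} (x~y : x ~ y) → TreeLike (x , y , x~y) → Admissible →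
                   otherWeight x y * otherWeight y x ≤ weight x y * weight x y
  otherWeights-≤ {x} {y} x~y tl admissible with admissible x~y
  ... | k , limit , 0≤k = ≤-by
    (*-nonneg (*-nonneg 0≤excess (wdegree-nonneg x)) (wdegree-nonneg y)) (begin-equality
      shareExcess x y * Dx * Dy
        -- The solver treats inverses as independent variables, so each is first paired with its own
        -- degree.
        ≈⟨ solve 6 (λ w w′ Dx Dy ix iy → (w :* ix :+ w′ :* iy :- con (+ 1)) :* Dx :* Dy
             := w :* Dy :* (Dx :* ix) :+ w′ :* Dx :* (Dy :* iy) :- Dx :* Dy)
             refl wxy wyx Dx Dy (Dx ⁻¹) (Dy ⁻¹) ⟩
      wxy * Dy * (Dx * Dx ⁻¹) + wyx * Dx * (Dy * Dy ⁻¹) - Dx * Dy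
        ≈⟨ +-congʳ (+-cong (*-congˡ (*-inverseʳ (wdegree≉0 x~y)))
                           (*-cong (*-congʳ wyx≈wxy) (*-inverseʳ (wdegree≉0 y~x)))) ⟩
      wxy * Dy * 1# + wxy * Dx * 1# - Dx * Dy
        ≈⟨ solve 3 (λ w Dx Dy → w :* Dy :* con (+ 1) :+ w :* Dx :* con (+ 1) :- Dx :* Dy
             := w :* w :- (Dx :- w) :* (Dy :- w)) refl wxy Dx Dy ⟩
      wxy * wxy - (Dx - wxy) * (Dy - wxy)
        ≈⟨ +-congˡ (-‿cong (*-congˡ (+-congˡ (-‿cong wyx≈wxy)))) ⟨
      wxy * wxy - (Dx - wxy) * (Dy - wyx) ∎)
    where
    y~x = ~-sym x~y
    Dx = wdegree x
    Dy = wdegree y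
    wxy = weight x y
    wyx = weight y x
    wyx≈wxy : wyx ≈ wxy
    wyx≈wxy = weight-sym y~x
    0≤excess : 0# ≤ shareExcess x y
    0≤excess = halve-nonneg (≤-trans 0≤k (LLY-≤ x~y tl limit))

  -- All excesses w - m at `x` are nonnegative, so the one at `y` is at most their sum. Rearranged,
  -- this leaves `degree x` minus one copies of `m`, with no need to delete `y` from the list.
  otherWeight-≥ : ∀ {x y m} → x ~ y → (∀ {z} → x ~ z → m ≤ weight x z) →
                  (fromℕ (degree x) - 1#) * m ≤ otherWeight x y
  otherWeight-≥ {x} {y} {m} x~y m≤ = ≤-by (≤⇒0≤- term≤) (begin-equality
    ∑ (nbrs x) (λ z → weight x z - m) - (weight x y - m)
      ≈⟨ +-congʳ (trans (∑-+ (nbrs x) _ _) (+-congˡ (∑-const (nbrs x) (- m)))) ⟩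
    wdegree x + fromℕ (degree x) * - m - (weight x y - m)
      ≈⟨ solve 4 (λ D n w m → D :+ n :* (:- m) :- (w :- m) := D :- w :- (n :- con (+ 1)) :* m) refl _ _ _ _ ⟩
    otherWeight x y - (fromℕ (degree x) - 1#) * m ∎)
    where
    term≤ : weight x y - m ≤ ∑ (nbrs x) (λ z → weight x z - m)
    term≤ = term≤∑ (nbrs x) (λ z∈ → ≤⇒0≤- (m≤ (nbrs⇒~ z∈))) (∈nbrs x~y)

  degree-1-nonneg : ∀ {x y} → x ~ y → 0# ≤ fromℕ (degree x) - 1#
  degree-1-nonneg x~y = ≤⇒0≤- (≤-trans
    (≤-reflexive (solve 0 (con (+ 1) := con (+ 1) :+ con (+ 0)) refl))
    (fromℕ-mono-≤ (∈⇒1≤length (∈nbrs x~y))))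
    where
    ∈⇒1≤length : ∀ {z} {zs : List V} → z ∈ zs → 1 ℕ.≤ length zs
    ∈⇒1≤length (here _)  = ℕ.s≤s ℕ.z≤n
    ∈⇒1≤length (there _) = ℕ.s≤s ℕ.z≤n

-- From the weight inequality to the distortion number

module DistortionBound (lem : ExcludedMiddle 0ℓ) (ℝ : CompleteOrderedField)
                       (G : Graph) (connected : Graph.Connected G) (lf : Graph.LocallyFinite G) where
  open CompleteOrderedField ℝ
  open ClassicalReals lem ℝ
  open Graph G
  open LocallyFinite lf
  open Curvature lem ℝ G lf
  open Weight
  open OrderedField lem ℝ
  open AddSupremum _≤_ using ([_]; _≤⊤⁺)
  open CommutativeRing commutativeRing using (refl; trans; *-cong; *-congˡ; *-identityʳ)
  open IntegerCoefficientSolver commutativeRing using (solve; _:*_; _:=_)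
  open IsTotalOrder isTotalOrder using () renaming (trans to ≤-trans; reflexive to ≤-reflexive)
  open PartialOrderReasoning ≤-poset

  sup⁺-isSup : {I : Set} (f : I → Carrier) {s : Carrier} → sup⁺ f ≡ [ s ] → IsSup f s
  sup⁺-isSup f eq with lem {∃ (IsSup f)}
  sup⁺-isSup f ≡.refl | yes (_ , isSup) = isSup

  -- If `a` has no square root, `√ a` takes the default 0, and 0 ≤ b settles the claim.
  √-≤ : ∀ {a b} → 0# ≤ b → a ≤ b * b → √ a ≤ b
  √-≤ {a} 0≤b a≤bb with lem {∃ λ r → 0# ≤ r × r * r ≈ a}
  ... | yes (r , _ , rr≈a) = square-cancel-≤ 0≤b (≤-trans (≤-reflexive rr≈a) a≤bb)
  ... | no  _              = 0≤b

  -- Inversion of `Dist`: a real value comes only from the branch with a real supremum and a nonzero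
  -- infimum.
  finite-Dist : ∀ (w : Weight) {r} → Dist w ≡ [ r ] →
    ∃ λ s → IsSup (onEdge w) s × ¬ inf (onEdge w) ≈ 0# × r ≡ s * inf (onEdge w) ⁻¹
  finite-Dist w eq with sup⁺ (onEdge w) in sup-eq | lem {inf (onEdge w) ≈ 0#}
  finite-Dist w ≡.refl | [ s ] | no m≉0 = s , sup⁺-isSup (onEdge w) sup-eq , m≉0 , ≡.refl

  degreeBound≤Dist : ∀ e → TreeLike e → ∀ (w : Weight) → Admissible w → ∀ {r} → Dist w ≡ [ r ] →
                     degreeBound e ≤ r
  degreeBound≤Dist e@(x , y , x~y) tl w admissible eq with finite-Dist w eq
  ... | s , (≤s , _) , m≉0 , ≡.refl = √-≤ (*-nonneg 0≤s (⁻¹-nonneg 0≤m)) (begin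
    a * b                              ≈⟨ *-identityʳ _ ⟨
    -- Division by m² is carried out by inserting `m * m ⁻¹` twice and regrouping.
    a * b * 1#                         ≈⟨ *-congˡ (trans (*-cong m/m≈1 m/m≈1) (*-identityʳ _)) ⟨
    a * b * ((m * m ⁻¹) * (m * m ⁻¹))  ≈⟨ solve 4 (λ a b m i → a :* b :* ((m :* i) :* (m :* i))
                                            := (a :* m) :* (b :* m) :* (i :* i)) refl a b m (m ⁻¹) ⟩
    (a * m) * (b * m) * (m ⁻¹ * m ⁻¹)  ≤⟨ *-monoʳ-≤ (square-nonneg (m ⁻¹)) ab≤ss ⟩
    s * s * (m ⁻¹ * m ⁻¹)              ≈⟨ solve 2 (λ s i → s :* s :* (i :* i) := (s :* i) :* (s :* i)) refl s (m ⁻¹) ⟩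
    (s * m ⁻¹) * (s * m ⁻¹)            ∎)
    where
    open CurvatureBound lem ℝ G connected lf w
    y~x = ~-sym x~y
    a = fromℕ (degree x) - 1#
    b = fromℕ (degree y) - 1#
    m = inf (onEdge w)
    0-lower : IsLowerBound (onEdge w) 0#
    0-lower (_ , _ , u~v) = proj₁ (weight-pos w u~v)
    m-isInf : IsInf (onEdge w) m
    m-isInf = inf-isInf (onEdge w) e 0-lower
    m≤ : ∀ {u v} → u ~ v → m ≤ weight w u v
    m≤ u~v = proj₁ m-isInf (_ , _ , u~v)
    0≤m : 0# ≤ m
    0≤m = proj₂ m-isInf 0# 0-lower
    0≤wxy : 0# ≤ weight w x y
    0≤wxy = 0-lower e
    0≤s : 0# ≤ s
    0≤s = ≤-trans 0≤wxy (≤s e)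
    m/m≈1 : m * m ⁻¹ ≈ 1#
    m/m≈1 = *-inverseʳ m≉0
    ab≤ss : (a * m) * (b * m) ≤ s * s
    ab≤ss = begin
      (a * m) * (b * m)                  ≤⟨ *-mono-≤ (*-nonneg (degree-1-nonneg y~x) 0≤m)
                                              (≤-trans (*-nonneg (degree-1-nonneg x~y) 0≤m) (otherWeight-≥ x~y m≤))
                                              (otherWeight-≥ x~y m≤) (otherWeight-≥ y~x m≤) ⟩
      otherWeight x y * otherWeight y x  ≤⟨ otherWeights-≤ x~y tl admissible ⟩
      weight w x y * weight w x y        ≤⟨ *-mono-≤ 0≤wxy 0≤s (≤s e) (≤s e) ⟩
      s * s                              ∎

  degreeBound-lower : ∀ e → TreeLike e → IsLowerBound distortion (degreeBound e)
  degreeBound-lower e tl (w , admissible , _ , eq) = degreeBound≤Dist e tl w admissible eq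

  degreeBound≤inf : ∀ e → TreeLike e → FiniteDistortion → degreeBound e ≤ inf distortion
  degreeBound≤inf e tl fd = proj₂ (inf-isInf distortion fd lower) _ lower
    where
    lower = degreeBound-lower e tl

  degreeBound≤DN : ∀ e → TreeLike e → [ degreeBound e ] ≤⁺ DN-LLY
  degreeBound≤DN e tl with lem {FiniteDistortion}
  ... | yes fd = [ degreeBound≤inf e tl fd ]
  ... | no  _  = _ ≤⊤⁺

  sup-degreeBound≤DN : E-tl → sup⁺ {E-tl} (degreeBound ∘ proj₁) ≤⁺ DN-LLY
  sup-degreeBound≤DN e₀ with lem {FiniteDistortion} | lem {∃ (IsSup {E-tl} (degreeBound ∘ proj₁))}
  ... | no  _  | _                 = _ ≤⊤⁺
  ... | yes fd | yes (_ , isSup)   = [ proj₂ isSup _ (λ (e , tl) → degreeBound≤inf e tl fd) ]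
  -- The finite value of `DN-LLY` bounds all degree bounds and `e₀` makes the family nonempty, so
  -- completeness excludes an infinite supremum.
  ... | yes fd | no  ∄sup          =
    contradiction (complete _ e₀ (_ , λ (e , tl) → degreeBound≤inf e tl fd)) ∄sup

corollary6p2 :
    (lem : ExcludedMiddle 0ℓ) (ℝ : CompleteOrderedField) →
    (G : Graph) → Graph.Connected G → (lf : Graph.LocallyFinite G) →
    let open CompleteOrderedField ℝ using (_≤⁺_)
        open ClassicalReals lem ℝ using (sup⁺)
        open Graph G
        open Curvature lem ℝ G lf
    in
    ((e : E) → TreeLike e → [ degreeBound e ] ≤⁺ DN-LLY) ×
    (E-tl → sup⁺ {E-tl} (degreeBound ∘ proj₁) ≤⁺ DN-LLY)
corollary6p2 lem ℝ G connected lf = degreeBound≤DN , sup-degreeBound≤DN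
  where open DistortionBound lem ℝ G connected lf
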